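{- Let $d\ge 1$ and $0<\alpha\le 1/2$. There is a constant $C$ (depending only on $d$ and $\alpha$) such that for every positive integer $n$ there exists an $n$-point set $S\subset\mathbb{R}^d$ such that the origin lies at depth $\alpha n$ with respect to $S$, but the origin is contained in at most $$\bigl((d+1)\alpha^d-2d\alpha^{d+1}\bigr)\frac{n^{d+1}}{(d+1)!}+C\,n^{d}$$ of the $d$-simplices spanned by $S$.
   Context: A point $p$ lies at depth $m$ with respect to a finite set $S\subset\mathbb{R}^d$ if every closed halfspace containing $p$ contains at least $m$ points of $S$. A $d$-simplex spanned by $S$ is the convex hull of a $(d+1)$-element subset of $S$; the count is over $(d+1)$-element subsets of $S$ whose convex hull contains the origin. -}

module Defs where

open import Algebra.Bundles using (CommutativeRing)
import Algebra.Properties.CommutativeMonoid.Sum as Sum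
import Algebra.Properties.Semiring.Exp as Exp
import Algebra.Properties.Semiring.Mult as Mult
open import Data.Fin.Base using (Fin)
open import Data.Fin.Subset using (Subset; _∉_; ∣_∣)
open import Data.List.Base using (length)
open import Data.List.Relation.Unary.All using (All)
open import Data.List.Relation.Unary.Unique.Propositional using (Unique)
open import Data.Nat.Base using (ℕ; suc)
open import Data.Product.Base using (∃; _×_)
open import Data.Vec.Functional using (Vector)
open import Level using (_⊔_) renaming (suc to lsuc)
open import Relation.Binary.Core using (Rel)
import Relation.Binary.Construct.NonStrictToStrict as NonStrictToStrict
open import Relation.Binary.PropositionalEquality.Core using (_≡_)
open import Relation.Binary.Structures using (IsDecTotalOrder)
open import Relation.Nullary.Negation.Core using (¬_)
open import Relation.Unary using (Pred)

-- The real numbers, given by the axioms that characterise them (classically)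
-- up to isomorphism.  Decidability of the order is part of the classical
-- notion of a total order; constructively it is an extra assumption.
record CompleteOrderedField c ℓ₁ ℓ₂ : Set (lsuc (c ⊔ ℓ₁ ⊔ ℓ₂)) where
  infix 8 _⁻¹
  infixl 7 _/_
  infix 4 _≤_ _<_

  field
    commutativeRing : CommutativeRing c ℓ₁

  open CommutativeRing commutativeRing public

  field
    _≤_             : Rel Carrier ℓ₂
    isDecTotalOrder : IsDecTotalOrder _≈_ _≤_
    +-monoˡ-≤       : ∀ z {x y} → x ≤ y → x + z ≤ y + z
    *-nonNegative   : ∀ {x y} → 0# ≤ x → 0# ≤ y → 0# ≤ x * y
    0≉1             : 0# ≉ 1#
    -- Total, but with an unspecified value at 0#.
    _⁻¹             : Carrier → Carrier
    ⁻¹-inverseʳ     : ∀ x → x ≉ 0# → x * x ⁻¹ ≈ 1#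

  UpperBound : ∀ {p} → Pred Carrier p → Pred Carrier (c ⊔ ℓ₂ ⊔ p)
  UpperBound P u = ∀ x → P x → x ≤ u

  field
    supremum : (P : Pred Carrier (c ⊔ ℓ₁ ⊔ ℓ₂)) → ∃ P → ∃ (UpperBound P) →
               ∃ λ s → UpperBound P s × (∀ u → UpperBound P u → s ≤ u)

  open Exp semiring public using (_^_)

  _<_ : Rel Carrier (ℓ₁ ⊔ ℓ₂)
  _<_ = NonStrictToStrict._<_ _≈_ _≤_

  _/_ : Carrier → Carrier → Carrier
  x / y = x * y ⁻¹

  fromℕ : ℕ → Carrier
  fromℕ n = n ×′ 1#
    where open Mult semiring using () renaming (_×_ to _×′_)

module Geometry {c ℓ₁ ℓ₂} (ℝ : CompleteOrderedField c ℓ₁ ℓ₂) where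

  open CompleteOrderedField ℝ
  open Sum +-commutativeMonoid using (sum)

  infix 4 _≋_ _∈ʰ_
  infix 7 _∙_

  Point : ℕ → Set c
  Point d = Vector Carrier d

  _≋_ : ∀ {d} → Rel (Point d) ℓ₁
  p ≋ q = ∀ k → p k ≈ q k

  origin : ∀ {d} → Point d
  origin _ = 0#

  _∙_ : ∀ {d} → Point d → Point d → Carrier
  a ∙ x = sum λ k → a k * x k

  -- An n-point set is given by an enumeration of its elements without
  -- repetition, so its subsets are subsets of the index set Fin n.
  record PointSet (d n : ℕ) : Set (c ⊔ ℓ₁) where
    field
      point    : Fin n → Point d
      distinct : ∀ {i j} → point i ≋ point j → i ≡ j

  open PointSet public

  -- Bounds on the cardinality of { a ∣ P a } by a real number.
  AtLeast : ∀ {a p} {A : Set a} → Carrier → Pred A p → Set (a ⊔ p ⊔ ℓ₂)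
  AtLeast m P = ∃ λ xs → Unique xs × All P xs × m ≤ fromℕ (length xs)

  AtMost : ∀ {a p} {A : Set a} → Carrier → Pred A p → Set (a ⊔ p ⊔ ℓ₂)
  AtMost m P = ∀ xs → Unique xs → All P xs → fromℕ (length xs) ≤ m

  record ClosedHalfspace (d : ℕ) : Set (c ⊔ ℓ₁) where
    field
      normal   : Point d
      offset   : Carrier
      normal≉0 : ¬ (normal ≋ origin)

  _∈ʰ_ : ∀ {d} → Point d → ClosedHalfspace d → Set ℓ₂
  x ∈ʰ H = offset ≤ normal ∙ x
    where open ClosedHalfspace H

  AtDepth : ∀ {d n} → Point d → Carrier → PointSet d n → Set (c ⊔ ℓ₁ ⊔ ℓ₂)
  AtDepth p m S = ∀ H → p ∈ʰ H → AtLeast m λ i → point S i ∈ʰ H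

  -- p is a convex combination of the points of S with index in I: the weights
  -- are defined on all of S but vanish outside I.
  InConvexHull : ∀ {d n} → Point d → PointSet d n → Subset n →
                 Set (c ⊔ ℓ₁ ⊔ ℓ₂)
  InConvexHull {n = n} p S I =
    ∃ λ (w : Fin n → Carrier) →
      (∀ i → 0# ≤ w i) ×
      (∀ i → i ∉ I → w i ≈ 0#) ×
      sum w ≈ 1# ×
      ((λ k → sum λ i → w i * point S i k) ≋ p)

  SimplexContaining : ∀ {d n} → Point d → PointSet d n →
                      Pred (Subset n) (c ⊔ ℓ₁ ⊔ ℓ₂)
  SimplexContaining {d} p S I = ∣ I ∣ ≡ suc d × InConvexHull p S I

{-# OPTIONS --safe #-}

-- Let k < αn ≤ k + 1 and n = 2k + 1 + m.  The points are multiples of points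
-- (1, t, …, t^(d-1)) of the moment curve: the origin, m positive multiples of
-- the point with the least parameter t, and, for each of k larger parameters,
-- one positive and one negative multiple.  A closed halfspace containing the
-- origin contains it and one point of each opposite pair, so the depth is at
-- least k + 1.  If a set of d + 1 points without the origin and without
-- opposite pairs has fewer than d sign changes in the order of the parameters,
-- then a polynomial of degree < d having the sign of each of its points at the
-- corresponding parameter separates it from the origin.  Hence, up to O(n^d)
-- sets, the simplices containing the origin have alternating signs, and there
-- are 2 C(k, d+1) + m C(k, d) alternating sets.

module Submission where

open import Defs
import Algebra.Properties.CommutativeSemiring.Exp as CommutativeExp
import Algebra.Properties.Ring as RingProperties
import Algebra.Properties.Semiring.Exp as Exp
import Algebra.Properties.Semiring.Mult as Mult
import Algebra.Properties.Semiring.Sum as SemiringSum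
import Algebra.Solver.Ring.NaturalCoefficients.Default as NaturalCoefficients
open import Data.Bool.Base using (Bool; true; false; not)
import Data.Bool.Properties as Bool
open import Data.Fin.Base using (Fin; zero; suc; toℕ; fromℕ<)
import Data.Fin.Properties as Fin
open import Data.Fin.Subset using (Subset; ∣_∣; _∈_; _∉_)
open import Data.Fin.Subset.Properties using (_∈?_)
open import Data.List.Base using (List; []; _∷_; _++_; foldr; length; lookup; map)
import Data.List.Membership.Propositional as List
open import Data.List.Membership.Propositional.Properties using (∈-map⁺; ∈-++⁺ˡ; ∈-++⁺ʳ; ∈-lookup)
open import Data.List.Properties using (length-map; length-++)
open import Data.List.Relation.Binary.Subset.Propositional using (_⊆_)
open import Data.List.Relation.Unary.All as All using (All; []; _∷_)
import Data.List.Relation.Unary.All.Properties as All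
open import Data.List.Relation.Unary.AllPairs using ([]; _∷_)
open import Data.List.Relation.Unary.Any as Any using (here)
open import Data.List.Relation.Unary.Any.Properties using (lookup-index)
open import Data.List.Relation.Unary.Unique.Propositional using (Unique)
import Data.List.Relation.Unary.Unique.Propositional.Properties as Unique
open import Data.Nat.Base as ℕ using (ℕ; zero; suc; z≤n; s≤s; _!)
import Data.Nat.Properties as ℕ
open import Data.Nat.Solver using (module +-*-Solver)
open import Data.Product.Base using (∃; _×_; _,_; proj₁; proj₂)
open import Data.Sum.Base using (inj₁; inj₂)
open import Data.Vec.Base using ([]; _∷_; there)
open import Function.Base using (_∘_)
open import Level using (_⊔_)
open import Relation.Binary.Bundles using (Poset)
import Relation.Binary.Construct.NonStrictToStrict as NonStrictToStrict
open import Relation.Binary.Definitions using (tri<; tri≈; tri>)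
open import Relation.Binary.PropositionalEquality as ≡ using (_≡_; cong; cong₂; subst)
import Relation.Binary.Reasoning.PartialOrder as PartialOrderReasoning
open import Relation.Binary.Structures using (IsDecTotalOrder)
open import Relation.Nullary.Decidable using (yes; no)
open import Relation.Nullary.Negation using (¬_; contradiction)

-- Lists without repetition and lists of subsets of a given size.

lookup-unique-injective : ∀ {a} {A : Set a} {xs : List A} → Unique xs →
                          ∀ i j → lookup xs i ≡ lookup xs j → i ≡ j
lookup-unique-injective (x∉ ∷ u) zero    zero    eq = ≡.refl
lookup-unique-injective (x∉ ∷ u) zero    (suc j) eq = contradiction eq (All.lookup x∉ (∈-lookup j))
lookup-unique-injective (x∉ ∷ u) (suc i) zero    eq = contradiction (≡.sym eq) (All.lookup x∉ (∈-lookup i))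
lookup-unique-injective (x∉ ∷ u) (suc i) (suc j) eq = cong suc (lookup-unique-injective u i j eq)

-- Pigeonhole: sending each position of `xs` to a position of the same element in `ys` is injective,
-- because `xs` has no repetition. This turns a list covering all simplices around the origin into
-- an upper bound on their number.
unique-⊆⇒length≤ : ∀ {a} {A : Set a} {xs ys : List A} → Unique xs → xs ⊆ ys →
                   length xs ℕ.≤ length ys
unique-⊆⇒length≤ {xs = xs} {ys} u xs⊆ys = Fin.injective⇒≤ {f = λ i → Any.index (mem i)} λ {i} {j} eq →
  lookup-unique-injective u i j
    (≡.trans (lookup-index (mem i)) (≡.trans (cong (lookup ys) eq) (≡.sym (lookup-index (mem j)))))
  where
  mem : ∀ i → lookup xs i List.∈ ys
  mem i = xs⊆ys (∈-lookup i)

subsets : ∀ n → ℕ → List (Subset n)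
subsets zero    zero    = [] ∷ []
subsets zero    (suc e) = []
subsets (suc n) zero    = map (false ∷_) (subsets n zero)
subsets (suc n) (suc e) = map (false ∷_) (subsets n (suc e)) ++ map (true ∷_) (subsets n e)

∈-subsets : ∀ {n} (I : Subset n) → I List.∈ subsets n ∣ I ∣
∈-subsets []          = here ≡.refl
∈-subsets (true ∷ I)  = ∈-++⁺ʳ _ (∈-map⁺ (true ∷_) (∈-subsets I))
∈-subsets (false ∷ I) with ∣ I ∣ | ∈-subsets I
... | zero  | I∈ = ∈-map⁺ (false ∷_) I∈
... | suc e | I∈ = ∈-++⁺ˡ (∈-map⁺ (false ∷_) I∈)

length-map-++ : ∀ {a b c} {A : Set a} {B : Set b} {C : Set c} (f : A → C) (g : B → C) xs ys →
                length (map f xs ++ map g ys) ≡ length xs ℕ.+ length ys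
length-map-++ f g xs ys =
  ≡.trans (length-++ (map f xs)) (cong₂ ℕ._+_ (length-map f xs) (length-map g ys))

length-subsets : ∀ n e → length (subsets n e) ℕ.≤ n ℕ.^ e
length-subsets zero    zero    = ℕ.≤-refl
length-subsets zero    (suc e) = z≤n
length-subsets (suc n) zero    =
  ℕ.≤-trans (ℕ.≤-reflexive (length-map _ (subsets n zero))) (length-subsets n zero)
length-subsets (suc n) (suc e) = begin
  length (subsets (suc n) (suc e))                 ≡⟨ length-map-++ _ _ (subsets n (suc e)) _ ⟩
  length (subsets n (suc e)) ℕ.+ length (subsets n e)
    ≤⟨ ℕ.+-mono-≤ (length-subsets n (suc e)) (length-subsets n e) ⟩
  n ℕ.* n ℕ.^ e ℕ.+ n ℕ.^ e                        ≡⟨ ℕ.+-comm _ (n ℕ.^ e) ⟩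
  suc n ℕ.* n ℕ.^ e                                ≤⟨ ℕ.*-monoʳ-≤ (suc n) (ℕ.^-monoˡ-≤ e (ℕ.n≤1+n n)) ⟩
  suc n ℕ.^ suc e                                  ∎
  where open ℕ.≤-Reasoning

length-subsets-1 : ∀ n → length (subsets n 1) ≡ n
length-subsets-1 zero    = ≡.refl
length-subsets-1 (suc n) = begin
  length (subsets (suc n) 1)                     ≡⟨ length-map-++ _ _ (subsets n 1) _ ⟩
  length (subsets n 1) ℕ.+ length (subsets n 0)  ≡⟨ cong₂ ℕ._+_ (length-subsets-1 n) (length-subsets-0 n) ⟩
  n ℕ.+ 1                                        ≡⟨ ℕ.+-comm n 1 ⟩
  suc n                                          ∎
  where
  open ≡.≡-Reasoning
  length-subsets-0 : ∀ n → length (subsets n 0) ≡ 1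
  length-subsets-0 zero    = ≡.refl
  length-subsets-0 (suc n) = ≡.trans (length-map _ (subsets n 0)) (length-subsets-0 n)

-- Counting degenerate and alternating index sets.

-- The indices of the points: k opposite pairs in order of decreasing parameter,
-- then the origin, then the m points with the least parameter.
size : ℕ → ℕ → ℕ
size m zero    = suc m
size m (suc k) = suc (suc (size m k))

single : ∀ {n} → Bool → Subset n → Subset (suc (suc n))
single s I = s ∷ not s ∷ I

none both : ∀ {n} → Subset n → Subset (suc (suc n))
none I = false ∷ false ∷ I
both I = true ∷ true ∷ I

-- These are the sets of the given size that contain the origin or both points of some opposite
-- pair. Once a pair is contained, the lower part of the set is arbitrary.
degenerate : ∀ m k → ℕ → List (Subset (size m k))
degenerate m zero    zero          = []
degenerate m zero    (suc e)       = map (true ∷_) (subsets m e)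
degenerate m (suc k) zero          = []
degenerate m (suc k) (suc zero)    = map none (degenerate m k 1)
degenerate m (suc k) (suc (suc e)) =
  (map none (degenerate m k (suc (suc e))) ++ map both (subsets (size m k) e)) ++
  (map (single true) (degenerate m k (suc e)) ++ map (single false) (degenerate m k (suc e)))

-- The sign is that of the first element, the one with the greatest parameter; the
-- two signs list the same sets (only the empty one) when the size is 0.
alternating : ∀ m k → Bool → ℕ → List (Subset (size m k))
alternating m zero    s     zero          = map (false ∷_) (subsets m 0)
alternating m zero    true  (suc zero)    = map (false ∷_) (subsets m 1)
alternating m zero    false (suc zero)    = []
alternating m zero    s     (suc (suc e)) = []
alternating m (suc k) s     zero          = map none (alternating m k s zero)
alternating m (suc k) s     (suc e)       =
  map none (alternating m k s (suc e)) ++ map (single s) (alternating m k (not s) e)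

-- With `K` the base for `k` pairs, a new pair adds at most three terms `K ^ e`, one from `both` and
-- two from `single`, and `K ^ (1 + e) + 3 * K ^ e` is at most `(3 + K) ^ (1 + e)`. Hence each pair
-- contributes 3 to the base. The exponent is one below the size of the sets, which puts them into
-- the error term.
length-degenerate : ∀ m k e → length (degenerate m k (suc e)) ℕ.≤ (3 ℕ.* k ℕ.+ suc m) ℕ.^ e
length-degenerate m zero    e = begin
  length (map (true ∷_) (subsets m e)) ≡⟨ length-map _ (subsets m e) ⟩
  length (subsets m e)                 ≤⟨ length-subsets m e ⟩
  m ℕ.^ e                              ≤⟨ ℕ.^-monoˡ-≤ e (ℕ.n≤1+n m) ⟩
  suc m ℕ.^ e                          ∎
  where open ℕ.≤-Reasoning
length-degenerate m (suc k) zero    =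
  ℕ.≤-trans (ℕ.≤-reflexive (length-map none (degenerate m k 1))) (length-degenerate m k 0)
length-degenerate m (suc k) (suc e) = begin
  length (degenerate m (suc k) (suc (suc e)))
    ≡⟨ length-++ (map none (degenerate m k (suc (suc e))) ++ map both (subsets (size m k) e)) ⟩
  length (map none (degenerate m k (suc (suc e))) ++ map both (subsets (size m k) e)) ℕ.+
    length (map (single true) (degenerate m k (suc e)) ++ map (single false) (degenerate m k (suc e)))
    ≡⟨ cong₂ ℕ._+_ (length-map-++ none both (degenerate m k (suc (suc e))) _)
                   (length-map-++ (single true) (single false) (degenerate m k (suc e)) _) ⟩
  (length (degenerate m k (suc (suc e))) ℕ.+ length (subsets (size m k) e)) ℕ.+
    (length (degenerate m k (suc e)) ℕ.+ length (degenerate m k (suc e)))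
    ≤⟨ ℕ.+-mono-≤ (ℕ.+-mono-≤ (length-degenerate m k (suc e))
                                (ℕ.≤-trans (length-subsets (size m k) e) (ℕ.^-monoˡ-≤ e (size≤ k))))
                  (ℕ.+-mono-≤ (length-degenerate m k e) (length-degenerate m k e)) ⟩
  (K ℕ.* K ℕ.^ e ℕ.+ K ℕ.^ e) ℕ.+ (K ℕ.^ e ℕ.+ K ℕ.^ e)
    ≡⟨ solve 2 (λ x y → (x :* y :+ y) :+ (y :+ y) := (con 3 :+ x) :* y) ≡.refl K (K ℕ.^ e) ⟩
  (3 ℕ.+ K) ℕ.* K ℕ.^ e
    ≤⟨ ℕ.*-monoʳ-≤ (3 ℕ.+ K) (ℕ.^-monoˡ-≤ e (ℕ.m≤n+m K 3)) ⟩
  (3 ℕ.+ K) ℕ.^ suc e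
    ≡⟨ cong (ℕ._^ suc e) (3+[3k+1+m] k) ⟩
  (3 ℕ.* suc k ℕ.+ suc m) ℕ.^ suc e ∎
  where
  open ℕ.≤-Reasoning
  open +-*-Solver
  K = 3 ℕ.* k ℕ.+ suc m
  3+[3k+1+m] : ∀ k → 3 ℕ.+ (3 ℕ.* k ℕ.+ suc m) ≡ 3 ℕ.* suc k ℕ.+ suc m
  3+[3k+1+m] k = solve 2 (λ k m → con 3 :+ (con 3 :* k :+ (con 1 :+ m))
                                  := con 3 :* (con 1 :+ k) :+ (con 1 :+ m)) ≡.refl k m
  size≤ : ∀ k → size m k ℕ.≤ 3 ℕ.* k ℕ.+ suc m
  size≤ zero    = ℕ.≤-refl
  size≤ (suc k) = begin
    2 ℕ.+ size m k               ≤⟨ ℕ.+-mono-≤ (ℕ.n≤1+n 2) (size≤ k) ⟩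
    3 ℕ.+ (3 ℕ.* k ℕ.+ suc m)    ≡⟨ 3+[3k+1+m] k ⟩
    3 ℕ.* suc k ℕ.+ suc m        ∎

-- These are the first two terms of the binomial expansion. The truncation in `e ∸ 1` takes effect
-- only at `e = 0`, where the coefficient `e` vanishes.
^-suc-lower : ∀ k e → k ℕ.^ e ℕ.+ e ℕ.* k ℕ.^ (e ℕ.∸ 1) ℕ.≤ suc k ℕ.^ e
^-suc-lower k zero          = ℕ.≤-refl
^-suc-lower k (suc zero)    = ℕ.≤-reflexive (solve 1 (λ k → k :* con 1 :+ con 1 := (con 1 :+ k) :* con 1) ≡.refl k)
  where open +-*-Solver
^-suc-lower k (suc (suc e)) = begin
  k ℕ.* (k ℕ.* x) ℕ.+ (2 ℕ.+ e) ℕ.* (k ℕ.* x)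
    ≤⟨ ℕ.m≤m+n _ ((1 ℕ.+ e) ℕ.* x) ⟩
  k ℕ.* (k ℕ.* x) ℕ.+ (2 ℕ.+ e) ℕ.* (k ℕ.* x) ℕ.+ (1 ℕ.+ e) ℕ.* x
    ≡⟨ solve 3 (λ k e x → k :* (k :* x) :+ (con 2 :+ e) :* (k :* x) :+ (con 1 :+ e) :* x
                          := (con 1 :+ k) :* (k :* x :+ (con 1 :+ e) :* x)) ≡.refl k e x ⟩
  suc k ℕ.* (k ℕ.* x ℕ.+ suc e ℕ.* x)
    ≤⟨ ℕ.*-monoʳ-≤ (suc k) (^-suc-lower k (suc e)) ⟩
  suc k ℕ.^ suc (suc e) ∎
  where
  open ℕ.≤-Reasoning
  open +-*-Solver
  x = k ℕ.^ e

-- An alternating set either takes `e` of the `k` parameters, with a free choice of the first sign,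
-- or one of the `m` lowest points and `e - 1` parameters, with all signs forced. This gives 2 C(k,
-- e) + m C(k, e - 1); multiplying by `e !` and replacing falling factorials by powers gives the
-- bound. Adding the two signs closes the Pascal recursion, and `^-suc-lower` compares it with the
-- growth of the powers.
length-alternating : ∀ m k e →
  e ! ℕ.* (length (alternating m k true e) ℕ.+ length (alternating m k false e)) ℕ.≤
  2 ℕ.* k ℕ.^ e ℕ.+ e ℕ.* (k ℕ.^ (e ℕ.∸ 1) ℕ.* m)
length-alternating m zero zero = begin
  1 ℕ.* (length (alternating m zero true zero) ℕ.+ length (alternating m zero false zero))
    ≡⟨ ℕ.*-identityˡ _ ⟩
  length (alternating m zero true zero) ℕ.+ length (alternating m zero false zero)
    ≤⟨ ℕ.+-mono-≤ l≤ l≤ ⟩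
  2 ∎
  where
  open ℕ.≤-Reasoning
  l≤ : length (map (false ∷_) (subsets m 0)) ℕ.≤ 1
  l≤ = ℕ.≤-trans (ℕ.≤-reflexive (length-map _ (subsets m 0))) (length-subsets m 0)
length-alternating m zero (suc zero) = begin
  1 ℕ.* (length (map (false ∷_) (subsets m 1)) ℕ.+ 0)
    ≡⟨ ℕ.*-identityˡ _ ⟩
  length (map (false ∷_) (subsets m 1)) ℕ.+ 0
    ≡⟨ cong (ℕ._+ 0) (≡.trans (length-map _ (subsets m 1)) (length-subsets-1 m)) ⟩
  m ℕ.+ 0
    ≡⟨ solve 1 (λ m → m :+ con 0 := con 1 :* (con 1 :* m)) ≡.refl m ⟩
  1 ℕ.* (1 ℕ.* m) ∎
  where
  open ℕ.≤-Reasoning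
  open +-*-Solver
length-alternating m zero (suc (suc e)) = ℕ.≤-trans (ℕ.≤-reflexive (ℕ.*-zeroʳ (suc (suc e) !))) z≤n
length-alternating m (suc k) zero = begin
  1 ℕ.* (length (map none (alternating m k true zero)) ℕ.+ length (map none (alternating m k false zero)))
    ≡⟨ cong (1 ℕ.*_) (cong₂ ℕ._+_ (length-map none (alternating m k true 0))
                                  (length-map none (alternating m k false 0))) ⟩
  1 ℕ.* (length (alternating m k true zero) ℕ.+ length (alternating m k false zero))
    ≤⟨ length-alternating m k zero ⟩
  2 ∎
  where open ℕ.≤-Reasoning
length-alternating m (suc k) (suc e) = begin
  suc e ℕ.* e ! ℕ.*
    (length (alternating m (suc k) true (suc e)) ℕ.+ length (alternating m (suc k) false (suc e)))
    ≡⟨ cong (suc e ℕ.* e ! ℕ.*_)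
         (cong₂ ℕ._+_ (length-map-++ none (single true) (alternating m k true (suc e)) _)
                      (length-map-++ none (single false) (alternating m k false (suc e)) _)) ⟩
  suc e ℕ.* e ! ℕ.* ((a₁ ℕ.+ b₀) ℕ.+ (b₁ ℕ.+ a₀))
    ≡⟨ solve 6 (λ f e a₁ b₀ b₁ a₀ → (con 1 :+ e) :* f :* ((a₁ :+ b₀) :+ (b₁ :+ a₀))
               := (con 1 :+ e) :* f :* (a₁ :+ b₁) :+ (con 1 :+ e) :* (f :* (a₀ :+ b₀)))
         ≡.refl (e !) e a₁ b₀ b₁ a₀ ⟩
  suc e ! ℕ.* (a₁ ℕ.+ b₁) ℕ.+ suc e ℕ.* (e ! ℕ.* (a₀ ℕ.+ b₀))
    ≤⟨ ℕ.+-mono-≤ (length-alternating m k (suc e)) (ℕ.*-monoʳ-≤ (suc e) (length-alternating m k e)) ⟩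
  2 ℕ.* (k ℕ.* x) ℕ.+ suc e ℕ.* (x ℕ.* m) ℕ.+ suc e ℕ.* (2 ℕ.* x ℕ.+ e ℕ.* (y ℕ.* m))
    ≡⟨ solve 5 (λ k x e y m → con 2 :* (k :* x) :+ (con 1 :+ e) :* (x :* m)
                 :+ (con 1 :+ e) :* (con 2 :* x :+ e :* (y :* m))
               := con 2 :* (k :* x :+ (con 1 :+ e) :* x) :+ (con 1 :+ e) :* ((x :+ e :* y) :* m))
         ≡.refl k x e y m ⟩
  2 ℕ.* (k ℕ.* x ℕ.+ suc e ℕ.* x) ℕ.+ suc e ℕ.* ((x ℕ.+ e ℕ.* y) ℕ.* m)
    ≤⟨ ℕ.+-mono-≤ (ℕ.*-monoʳ-≤ 2 (^-suc-lower k (suc e)))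
                  (ℕ.*-monoʳ-≤ (suc e) (ℕ.*-monoˡ-≤ m (^-suc-lower k e))) ⟩
  2 ℕ.* suc k ℕ.^ suc e ℕ.+ suc e ℕ.* (suc k ℕ.^ e ℕ.* m) ∎
  where
  open ℕ.≤-Reasoning
  open +-*-Solver
  x = k ℕ.^ e
  y = k ℕ.^ (e ℕ.∸ 1)
  a₁ = length (alternating m k true (suc e))
  b₁ = length (alternating m k false (suc e))
  a₀ = length (alternating m k true e)
  b₀ = length (alternating m k false e)

-- How the lists of sets behave when a pair is put on top.

skip : ∀ {n} → Fin n → Fin (suc (suc n))
skip i = suc (suc i)

degenerate-none : ∀ {m} k {e} {I : Subset (size m k)} →
                  I List.∈ degenerate m k e → none I List.∈ degenerate m (suc k) e
degenerate-none zero    {zero}        ()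
degenerate-none (suc k) {zero}        ()
degenerate-none k       {suc zero}    I∈ = ∈-map⁺ none I∈
degenerate-none k       {suc (suc e)} I∈ = ∈-++⁺ˡ (∈-++⁺ˡ (∈-map⁺ none I∈))

degenerate-single : ∀ {m} k s {e} {I : Subset (size m k)} →
                    I List.∈ degenerate m k e → single s I List.∈ degenerate m (suc k) (suc e)
degenerate-single zero    s     {zero}  ()
degenerate-single (suc k) s     {zero}  ()
degenerate-single {m} k   true  {suc e} I∈ =
  ∈-++⁺ʳ (map none (degenerate m k _) ++ _) (∈-++⁺ˡ (∈-map⁺ (single true) I∈))
degenerate-single {m} k   false {suc e} I∈ =
  ∈-++⁺ʳ (map none (degenerate m k _) ++ _)
    (∈-++⁺ʳ (map (single true) (degenerate m k _)) (∈-map⁺ (single false) I∈))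

degenerate-both : ∀ {m} k (I : Subset (size m k)) → both I List.∈ degenerate m (suc k) ∣ both I ∣
degenerate-both {m} k I =
  ∈-++⁺ˡ (∈-++⁺ʳ (map none (degenerate m k _)) (∈-map⁺ both (∈-subsets I)))

alternating-none : ∀ {m} k s e {I : Subset (size m k)} →
                   I List.∈ alternating m k s e → none I List.∈ alternating m (suc k) s e
alternating-none k s zero    I∈ = ∈-map⁺ none I∈
alternating-none k s (suc e) I∈ = ∈-++⁺ˡ (∈-map⁺ none I∈)

alternating-single : ∀ {m} k s e {I : Subset (size m k)} →
                     I List.∈ alternating m k (not s) e → single s I List.∈ alternating m (suc k) s (suc e)
alternating-single {m} k s e I∈ = ∈-++⁺ʳ (map none (alternating m k s (suc e))) (∈-map⁺ (single s) I∈)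

∣single∣ : ∀ {n} s (I : Subset n) → ∣ single s I ∣ ≡ suc ∣ I ∣
∣single∣ true  I = ≡.refl
∣single∣ false I = ≡.refl

∣I∣≡0⇒∉ : ∀ {n} (I : Subset n) → ∣ I ∣ ≡ 0 → ∀ i → i ∉ I
∣I∣≡0⇒∉ (false ∷ I) ∣I∣≡0 (suc i) (there i∈I) = ∣I∣≡0⇒∉ I ∣I∣≡0 i i∈I

candidates : ∀ m k → ℕ → List (Subset (size m k))
candidates m k e = degenerate m k e ++ (alternating m k true e ++ alternating m k false e)

size≡ : ∀ m k → size m k ≡ suc (2 ℕ.* k) ℕ.+ m
size≡ m zero    = ≡.refl
size≡ m (suc k) = ≡.trans (cong (2 ℕ.+_) (size≡ m k))
  (solve 2 (λ m k → con 2 :+ (con 1 :+ con 2 :* k :+ m) := con 1 :+ con 2 :* (con 1 :+ k) :+ m) ≡.refl m k)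
  where open +-*-Solver

-- The alternating sets, counted by `l`, are kept apart because their number needs a sharp leading
-- coefficient. The degenerate sets only need some constant multiple of the `d`-th power of the
-- number of points.
length-candidates : ∀ m k d → ∃ λ l →
  length (candidates m k (suc d)) ℕ.≤ (2 ℕ.* size m k) ℕ.^ d ℕ.+ l ×
  suc d ! ℕ.* l ℕ.≤ 2 ℕ.* k ℕ.^ suc d ℕ.+ suc d ℕ.* (k ℕ.^ d ℕ.* m)
length-candidates m k d =
  length (alternating m k true (suc d)) ℕ.+ length (alternating m k false (suc d)) ,
  (begin
    length (candidates m k (suc d))
      ≡⟨ length-++ (degenerate m k (suc d)) ⟩
    length (degenerate m k (suc d)) ℕ.+ length (alternating m k true (suc d) ++ alternating m k false (suc d))
      ≡⟨ cong (length (degenerate m k (suc d)) ℕ.+_) (length-++ (alternating m k true (suc d))) ⟩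
    length (degenerate m k (suc d)) ℕ.+ _
      ≤⟨ ℕ.+-monoˡ-≤ _ (ℕ.≤-trans (length-degenerate m k d) (ℕ.^-monoˡ-≤ d 3k+1+m≤2*size)) ⟩
    (2 ℕ.* size m k) ℕ.^ d ℕ.+ _ ∎) ,
  length-alternating m k (suc d)
  where
  open ℕ.≤-Reasoning
  3k+1+m≤2*size : 3 ℕ.* k ℕ.+ suc m ℕ.≤ 2 ℕ.* size m k
  3k+1+m≤2*size = begin
    3 ℕ.* k ℕ.+ suc m
      ≤⟨ ℕ.m≤m+n _ (k ℕ.+ suc m) ⟩
    3 ℕ.* k ℕ.+ suc m ℕ.+ (k ℕ.+ suc m)
      ≡⟨ solve 2 (λ k m → con 3 :* k :+ (con 1 :+ m) :+ (k :+ (con 1 :+ m))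
                          := con 2 :* (con 1 :+ con 2 :* k :+ m)) ≡.refl k m ⟩
    2 ℕ.* (suc (2 ℕ.* k) ℕ.+ m)
      ≡⟨ cong (2 ℕ.*_) (≡.sym (size≡ m k)) ⟩
    2 ℕ.* size m k ∎
    where open +-*-Solver

-- Arithmetic of ordered fields and the embedding of the natural numbers.

module OrderedFieldProperties {c ℓ₁ ℓ₂} (ℝ : CompleteOrderedField c ℓ₁ ℓ₂) where

  open CompleteOrderedField ℝ hiding (zero)
  open RingProperties ring
  open Mult semiring using (×-homo-+; ×1-homo-*)
  open SemiringSum semiring using (sum)
  open IsDecTotalOrder isDecTotalOrder public
    using (antisym; total; ≤-respˡ-≈; ≤-respʳ-≈; isPartialOrder; _≤?_)
    renaming (refl to ≤-refl; reflexive to ≤-reflexive; trans to ≤-trans)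

  poset : Poset _ _ _
  poset = record { isPartialOrder = isPartialOrder }

  module ≤-Reasoning = PartialOrderReasoning poset
  open ≤-Reasoning

  +-monoʳ-≤ : ∀ z {x y} → x ≤ y → z + x ≤ z + y
  +-monoʳ-≤ z {x} {y} x≤y = begin
    z + x ≈⟨ +-comm z x ⟩
    x + z ≤⟨ +-monoˡ-≤ z x≤y ⟩
    y + z ≈⟨ +-comm y z ⟩
    z + y ∎

  +-mono-≤ : ∀ {x y u v} → x ≤ y → u ≤ v → x + u ≤ y + v
  +-mono-≤ {y = y} {u} x≤y u≤v = ≤-trans (+-monoˡ-≤ u x≤y) (+-monoʳ-≤ y u≤v)

  +-nonNegative : ∀ {x y} → 0# ≤ x → 0# ≤ y → 0# ≤ x + y
  +-nonNegative 0≤x 0≤y = ≤-respˡ-≈ (+-identityˡ 0#) (+-mono-≤ 0≤x 0≤y)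

  x≤y⇒0≤y-x : ∀ {x y} → x ≤ y → 0# ≤ y - x
  x≤y⇒0≤y-x {x} {y} x≤y = begin
    0#    ≈⟨ -‿inverseʳ x ⟨
    x - x ≤⟨ +-monoˡ-≤ (- x) x≤y ⟩
    y - x ∎

  [y-x]+x≈y : ∀ x y → (y - x) + x ≈ y
  [y-x]+x≈y x y = trans (+-assoc y (- x) x) (trans (+-congˡ (-‿inverseˡ x)) (+-identityʳ y))

  0≤y-x⇒x≤y : ∀ {x y} → 0# ≤ y - x → x ≤ y
  0≤y-x⇒x≤y {x} {y} 0≤y-x = begin
    x           ≈⟨ +-identityˡ x ⟨
    0# + x      ≤⟨ +-monoˡ-≤ x 0≤y-x ⟩
    (y - x) + x ≈⟨ [y-x]+x≈y x y ⟩
    y           ∎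

  +-cancelʳ-≤ : ∀ z {x y} → x + z ≤ y + z → x ≤ y
  +-cancelʳ-≤ z {x} {y} x+z≤y+z = begin
    x             ≈⟨ x+z-z≈x x ⟨
    (x + z) - z   ≤⟨ +-monoˡ-≤ (- z) x+z≤y+z ⟩
    (y + z) - z   ≈⟨ x+z-z≈x y ⟩
    y             ∎
    where
    x+z-z≈x : ∀ x → (x + z) - z ≈ x
    x+z-z≈x x = trans (+-assoc x z (- z)) (trans (+-congˡ (-‿inverseʳ z)) (+-identityʳ x))

  x≤0⇒0≤-x : ∀ {x} → x ≤ 0# → 0# ≤ - x
  x≤0⇒0≤-x {x} x≤0 = ≤-respʳ-≈ (+-identityˡ (- x)) (x≤y⇒0≤y-x x≤0)

  0≤x⇒-x≤0 : ∀ {x} → 0# ≤ x → - x ≤ 0#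
  0≤x⇒-x≤0 {x} 0≤x = 0≤y-x⇒x≤y (≤-respʳ-≈ (trans (sym (-‿involutive x)) (sym (+-identityˡ _))) 0≤x)

  *-monoʳ-≤ : ∀ {z} → 0# ≤ z → ∀ {x y} → x ≤ y → z * x ≤ z * y
  *-monoʳ-≤ {z} 0≤z {x} {y} x≤y = 0≤y-x⇒x≤y (begin
    0#              ≤⟨ *-nonNegative 0≤z (x≤y⇒0≤y-x x≤y) ⟩
    z * (y - x)     ≈⟨ distribˡ z y (- x) ⟩
    z * y + z * - x ≈⟨ +-congˡ (-‿distribʳ-* z x) ⟨
    z * y - z * x   ∎)

  *-monoˡ-≤ : ∀ {z} → 0# ≤ z → ∀ {x y} → x ≤ y → x * z ≤ y * z
  *-monoˡ-≤ {z} 0≤z {x} {y} x≤y = begin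
    x * z ≈⟨ *-comm x z ⟩
    z * x ≤⟨ *-monoʳ-≤ 0≤z x≤y ⟩
    z * y ≈⟨ *-comm z y ⟩
    y * z ∎

  *-mono-≤ : ∀ {x y u v} → 0# ≤ x → 0# ≤ v → x ≤ y → u ≤ v → x * u ≤ y * v
  *-mono-≤ 0≤x 0≤v x≤y u≤v = ≤-trans (*-monoʳ-≤ 0≤x u≤v) (*-monoˡ-≤ 0≤v x≤y)

  0≤1 : 0# ≤ 1#
  0≤1 with total 0# 1#
  ... | inj₁ 0≤1 = 0≤1
  ... | inj₂ 1≤0 = begin
    0#          ≤⟨ *-nonNegative (x≤0⇒0≤-x 1≤0) (x≤0⇒0≤-x 1≤0) ⟩
    - 1# * - 1# ≈⟨ -1*x≈-x (- 1#) ⟩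
    - (- 1#)    ≈⟨ -‿involutive 1# ⟩
    1#          ∎

  0<1 : 0# < 1#
  0<1 = 0≤1 , 0≉1

  <⇒≱ : ∀ {x y} → x < y → ¬ (y ≤ x)
  <⇒≱ = NonStrictToStrict.<⇒≱ _≈_ _≤_ antisym

  <-respʳ-≈ : ∀ {x y z} → y ≈ z → x < y → x < z
  <-respʳ-≈ = NonStrictToStrict.<-respʳ-≈ _≈_ _≤_ sym trans ≤-respʳ-≈

  <-trans : ∀ {x y z} → x < y → y < z → x < z
  <-trans = NonStrictToStrict.<-trans _≈_ _≤_ isPartialOrder

  ≤-<-trans : ∀ {x y z} → x ≤ y → y < z → x < z
  ≤-<-trans = NonStrictToStrict.≤-<-trans _≈_ _≤_ ≤-trans antisym ≤-respˡ-≈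

  ≰⇒> : ∀ {x y} → ¬ (x ≤ y) → y < x
  ≰⇒> = NonStrictToStrict.≰⇒> _≈_ _≤_ sym ≤-reflexive total

  x<y⇒0<y-x : ∀ {x y} → x < y → 0# < y - x
  x<y⇒0<y-x {x} {y} (x≤y , x≉y) =
    x≤y⇒0≤y-x x≤y , λ 0≈y-x → x≉y (trans (sym (+-identityˡ x)) (trans (+-congʳ 0≈y-x) ([y-x]+x≈y x y)))

  x<x+1 : ∀ x → x < x + 1#
  x<x+1 x = ≤-respˡ-≈ (+-identityʳ x) (+-monoʳ-≤ x 0≤1) ,
    λ x≈x+1 → 0≉1 (+-cancelˡ x 0# 1# (trans (+-identityʳ x) x≈x+1))

  ≉0-cancelˡ : ∀ {x y} → x ≉ 0# → x * y ≈ 0# → y ≈ 0#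
  ≉0-cancelˡ {x} {y} x≉0 xy≈0 = begin-equality
    y              ≈⟨ *-identityˡ y ⟨
    1# * y         ≈⟨ *-congʳ (⁻¹-inverseʳ x x≉0) ⟨
    x * x ⁻¹ * y   ≈⟨ *-congʳ (*-comm x (x ⁻¹)) ⟩
    x ⁻¹ * x * y   ≈⟨ *-assoc (x ⁻¹) x y ⟩
    x ⁻¹ * (x * y) ≈⟨ *-congˡ xy≈0 ⟩
    x ⁻¹ * 0#      ≈⟨ zeroʳ (x ⁻¹) ⟩
    0#             ∎

  *-positive : ∀ {x y} → 0# < x → 0# < y → 0# < x * y
  *-positive (0≤x , 0≉x) (0≤y , 0≉y) =
    *-nonNegative 0≤x 0≤y , λ 0≈xy → 0≉y (sym (≉0-cancelˡ (0≉x ∘ sym) (sym 0≈xy)))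

  ⁻¹-nonNegative : ∀ {x} → 0# < x → 0# ≤ x ⁻¹
  ⁻¹-nonNegative {x} (0≤x , 0≉x) with total 0# (x ⁻¹)
  ... | inj₁ 0≤x⁻¹ = 0≤x⁻¹
  ... | inj₂ x⁻¹≤0 = contradiction (begin
    0#            ≤⟨ *-nonNegative 0≤x (x≤0⇒0≤-x x⁻¹≤0) ⟩
    x * - (x ⁻¹)  ≈⟨ -‿distribʳ-* x (x ⁻¹) ⟨
    - (x * x ⁻¹)  ≈⟨ -‿cong (⁻¹-inverseʳ x (0≉x ∘ sym)) ⟩
    - 1#          ∎) (<⇒≱ 1<0)
    where
    1<0 : - 1# < 0#
    1<0 = 0≤x⇒-x≤0 0≤1 , λ -1≈0 → 0≉1 (-‿injective (trans -0#≈0# (sym -1≈0)))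

  y*x≤z⇒x≤z/y : ∀ {x y z} → 0# < y → y * x ≤ z → x ≤ z / y
  y*x≤z⇒x≤z/y {x} {y} {z} 0<y y*x≤z = begin
    x              ≈⟨ *-identityˡ x ⟨
    1# * x         ≈⟨ *-congʳ (⁻¹-inverseʳ y (proj₂ 0<y ∘ sym)) ⟨
    y * y ⁻¹ * x   ≈⟨ trans (*-assoc y (y ⁻¹) x) (trans (*-congˡ (*-comm (y ⁻¹) x)) (sym (*-assoc y x (y ⁻¹)))) ⟩
    y * x * y ⁻¹   ≤⟨ *-monoˡ-≤ (⁻¹-nonNegative 0<y) y*x≤z ⟩
    z / y          ∎

  ^-nonNegative : ∀ {x} → 0# ≤ x → ∀ n → 0# ≤ x ^ n
  ^-nonNegative 0≤x zero    = 0≤1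
  ^-nonNegative 0≤x (suc n) = *-nonNegative 0≤x (^-nonNegative 0≤x n)

  ^-monoˡ-≤ : ∀ {x y} → 0# ≤ x → x ≤ y → ∀ n → x ^ n ≤ y ^ n
  ^-monoˡ-≤ 0≤x x≤y zero    = ≤-refl
  ^-monoˡ-≤ 0≤x x≤y (suc n) =
    *-mono-≤ 0≤x (^-nonNegative (≤-trans 0≤x x≤y) n) x≤y (^-monoˡ-≤ 0≤x x≤y n)

  *-monoʳ-< : ∀ {z} → 0# < z → ∀ {x y} → x < y → z * x < z * y
  *-monoʳ-< {z} 0<z {x} {y} x<y = *-monoʳ-≤ (proj₁ 0<z) (proj₁ x<y) , λ zx≈zy →
    proj₂ (*-positive 0<z (x<y⇒0<y-x x<y)) (begin-equality
      0#              ≈⟨ -‿inverseʳ (z * x) ⟨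
      z * x - z * x   ≈⟨ +-congʳ zx≈zy ⟩
      z * y - z * x   ≈⟨ +-congˡ (-‿distribʳ-* z x) ⟩
      z * y + z * - x ≈⟨ distribˡ z y (- x) ⟨
      z * (y - x)     ∎)

  fromℕ-+ : ∀ m n → fromℕ (m ℕ.+ n) ≈ fromℕ m + fromℕ n
  fromℕ-+ = ×-homo-+ 1#

  fromℕ-* : ∀ m n → fromℕ (m ℕ.* n) ≈ fromℕ m * fromℕ n
  fromℕ-* = ×1-homo-*

  fromℕ-^ : ∀ m n → fromℕ (m ℕ.^ n) ≈ fromℕ m ^ n
  fromℕ-^ m zero    = +-identityʳ 1#
  fromℕ-^ m (suc n) = trans (fromℕ-* m (m ℕ.^ n)) (*-congˡ (fromℕ-^ m n))

  fromℕ-nonNegative : ∀ n → 0# ≤ fromℕ n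
  fromℕ-nonNegative zero    = ≤-refl
  fromℕ-nonNegative (suc n) = +-nonNegative 0≤1 (fromℕ-nonNegative n)

  fromℕ-mono-≤ : ∀ {m n} → m ℕ.≤ n → fromℕ m ≤ fromℕ n
  fromℕ-mono-≤ {n = n} z≤n = fromℕ-nonNegative n
  fromℕ-mono-≤ (s≤s m≤n)   = +-monoʳ-≤ 1# (fromℕ-mono-≤ m≤n)

  fromℕ<fromℕ-suc : ∀ n → fromℕ n < fromℕ (suc n)
  fromℕ<fromℕ-suc n = begin-strict
    fromℕ n      <⟨ x<x+1 (fromℕ n) ⟩
    fromℕ n + 1# ≈⟨ +-comm (fromℕ n) 1# ⟩
    1# + fromℕ n ∎

  fromℕ-mono-< : ∀ {m n} → m ℕ.< n → fromℕ m < fromℕ n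
  fromℕ-mono-< {m} {n} m<n = begin-strict
    fromℕ m       <⟨ fromℕ<fromℕ-suc m ⟩
    fromℕ (suc m) ≤⟨ fromℕ-mono-≤ m<n ⟩
    fromℕ n       ∎

  fromℕ-cancel-< : ∀ m n → fromℕ m < fromℕ n → m ℕ.< n
  fromℕ-cancel-< m n m<n = ℕ.≰⇒> λ n≤m → <⇒≱ m<n (fromℕ-mono-≤ n≤m)

  fromℕ-injective : ∀ {i j} → fromℕ i ≈ fromℕ j → i ≡ j
  fromℕ-injective {i} {j} eq with ℕ.<-cmp i j
  ... | tri< i<j _ _ = contradiction eq (proj₂ (fromℕ-mono-< {i} {j} i<j))
  ... | tri≈ _ i≡j _ = i≡j
  ... | tri> _ _ j<i = contradiction (sym eq) (proj₂ (fromℕ-mono-< {j} {i} j<i))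

  -- The number is found by descending from `n` until it drops below `β`. The strict lower
  -- inequality matters later: it leaves room for the origin besides the `k` pairs even when α =
  -- 1/2.
  ⌈_⌉-1 : ∀ {β} n → 0# < β → β ≤ fromℕ n → ∃ λ k → fromℕ k < β × β ≤ fromℕ (suc k)
  ⌈ zero ⌉-1      0<β β≤0 = contradiction β≤0 (<⇒≱ 0<β)
  ⌈_⌉-1 {β} (suc n) 0<β β≤1+n with β ≤? fromℕ n
  ... | yes β≤n = ⌈ n ⌉-1 0<β β≤n
  ... | no  β≰n = n , ≰⇒> β≰n , β≤1+n

  sum-nonNegative : ∀ {n} (f : Fin n → Carrier) → (∀ i → 0# ≤ f i) → 0# ≤ sum f
  sum-nonNegative {zero}  f 0≤f = ≤-refl
  sum-nonNegative {suc n} f 0≤f = +-nonNegative (0≤f zero) (sum-nonNegative (f ∘ suc) (0≤f ∘ suc))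

  nonNegative-sum≈0⇒≈0 : ∀ {n} (f : Fin n → Carrier) → (∀ i → 0# ≤ f i) → sum f ≈ 0# → ∀ i → f i ≈ 0#
  nonNegative-sum≈0⇒≈0 f 0≤f Σf≈0 zero = antisym (begin
    f zero                    ≈⟨ +-identityʳ (f zero) ⟨
    f zero + 0#               ≤⟨ +-monoʳ-≤ (f zero) (sum-nonNegative (f ∘ suc) (0≤f ∘ suc)) ⟩
    f zero + sum (f ∘ suc)    ≈⟨ Σf≈0 ⟩
    0#                        ∎) (0≤f zero)
  nonNegative-sum≈0⇒≈0 f 0≤f Σf≈0 (suc i) = nonNegative-sum≈0⇒≈0 (f ∘ suc) (0≤f ∘ suc) (begin-equality
    sum (f ∘ suc)          ≈⟨ +-identityˡ _ ⟨
    0# + sum (f ∘ suc)     ≈⟨ +-congʳ (nonNegative-sum≈0⇒≈0 f 0≤f Σf≈0 zero) ⟨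
    f zero + sum (f ∘ suc) ≈⟨ Σf≈0 ⟩
    0#                     ∎) i

-- Separating points over the moment curve from the origin by polynomials.

module Separation {c ℓ₁ ℓ₂} (ℝ : CompleteOrderedField c ℓ₁ ℓ₂) where

  open CompleteOrderedField ℝ hiding (zero)
  open Geometry ℝ
  open OrderedFieldProperties ℝ
  open RingProperties ring
  open SemiringSum semiring using (sum; sum-cong-≋; ∑-distrib-+; *-distribˡ-sum; sum-replicate-zero)

  signed : Bool → Carrier → Carrier
  signed true  x = x
  signed false x = - x

  signed-cong : ∀ s {x y} → x ≈ y → signed s x ≈ signed s y
  signed-cong true  x≈y = x≈y
  signed-cong false x≈y = -‿cong x≈y

  *-signed : ∀ s x y → x * signed s y ≈ signed s (x * y)
  *-signed true  x y = refl
  *-signed false x y = sym (-‿distribʳ-* x y)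

  signed-* : ∀ s x y → signed s x * y ≈ signed s (x * y)
  signed-* true  x y = refl
  signed-* false x y = sym (-‿distribˡ-* x y)

  signed-involutive : ∀ s x → signed s (signed s x) ≈ x
  signed-involutive true  x = refl
  signed-involutive false x = -‿involutive x

  signed-not-neg : ∀ s x → signed (not s) (- x) ≈ signed s x
  signed-not-neg true  x = -‿involutive x
  signed-not-neg false x = refl

  signed-0 : ∀ s → signed s 0# ≈ 0#
  signed-0 true  = refl
  signed-0 false = -0#≈0#

  signed-sum : ∀ s {n} (f : Fin n → Carrier) → sum (signed s ∘ f) ≈ signed s (sum f)
  signed-sum true  f = refl
  signed-sum false f = trans (sum-cong-≋ (sym ∘ -1*x≈-x ∘ f))
    (trans (sym (*-distribˡ-sum (- 1#) f)) (-1*x≈-x (sum f)))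

  -- Polynomials are monic and given by their roots: the degree is the length of the list, the sign
  -- changes can be placed at will, and the value is positive beyond the last root.
  eval : List Carrier → Carrier → Carrier
  eval rs t = foldr (λ r y → (t - r) * y) 1# rs

  eval-positive : ∀ {rs t} → All (_< t) rs → 0# < eval rs t
  eval-positive []         = 0<1
  eval-positive (r<t ∷ rs) = *-positive (x<y⇒0<y-x r<t) (eval-positive rs)

  -- If the moments of order below `d` vanish, then so does the pairing with every polynomial of
  -- degree below `d`. The additional factor `t i ^ j` is what lets the induction remove one root at
  -- a time: multiplying by `t - r` raises `j` in one summand and scales the other by `- r`.
  moment-eval : ∀ {n} d (u t : Fin n → Carrier) →
                (∀ j → j ℕ.< d → sum (λ i → u i * t i ^ j) ≈ 0#) →
                ∀ rs j → length rs ℕ.+ j ℕ.< d → sum (λ i → u i * (eval rs (t i) * t i ^ j)) ≈ 0#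
  moment-eval d u t moment≈0 []       j j<d =
    trans (sum-cong-≋ λ i → *-congˡ (*-identityˡ (t i ^ j))) (moment≈0 j j<d)
  moment-eval d u t moment≈0 (r ∷ rs) j l+j<d = begin-equality
    sum (λ i → u i * (((t i - r) * eval rs (t i)) * t i ^ j))
      ≈⟨ sum-cong-≋ (λ i → solve 5 (λ u t r e q → u :* (((t :+ r) :* e) :* q)
                                                    := u :* (e :* (t :* q)) :+ r :* (u :* (e :* q)))
                             refl (u i) (t i) (- r) (eval rs (t i)) (t i ^ j)) ⟩
    sum (λ i → u i * (eval rs (t i) * t i ^ suc j) + - r * f i)
      ≈⟨ ∑-distrib-+ (λ i → u i * (eval rs (t i) * t i ^ suc j)) (λ i → - r * f i) ⟩
    sum (λ i → u i * (eval rs (t i) * t i ^ suc j)) + sum (λ i → - r * f i)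
      ≈⟨ +-cong (moment-eval d u t moment≈0 rs (suc j) (subst (ℕ._< d) (≡.sym (ℕ.+-suc (length rs) j)) l+j<d))
                (trans (sym (*-distribˡ-sum (- r) f))
                  (*-congˡ (moment-eval d u t moment≈0 rs j (ℕ.<-trans ℕ.≤-refl l+j<d)))) ⟩
    0# + - r * 0#
      ≈⟨ trans (+-identityˡ _) (zeroʳ (- r)) ⟩
    0# ∎
    where
    open ≤-Reasoning
    open NaturalCoefficients commutativeSemiring
    f = λ i → u i * (eval rs (t i) * t i ^ j)

  -- A polynomial of degree below `d` is a linear functional on the points `(1, t, …, t^(d-1))`.
  -- Applied to a convex combination equal to the origin, it gives a vanishing sum of nonnegative
  -- terms. Each weight on `I` has a positive factor, so all weights vanish, although they sum to 1.
  separated⇒∉hull : ∀ {d n} (S : PointSet d n) (I : Subset n) (x t : Fin n → Carrier) →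
    (∀ i j → point S i j ≈ x i * t i ^ toℕ j) →
    ∀ s rs → length rs ℕ.< d → (∀ i → i ∈ I → 0# < signed s (x i * eval rs (t i))) →
    ¬ InConvexHull origin S I
  separated⇒∉hull {d} {n} S I x t point≈ s rs l<d positive (w , 0≤w , w∉≈0 , Σw≈1 , combination≈0) =
    0≉1 (trans (trans (sym (sum-replicate-zero n)) (sum-cong-≋ (sym ∘ w≈0))) Σw≈1)
    where
    open ≤-Reasoning
    open NaturalCoefficients commutativeSemiring
    moment≈0 : ∀ j → j ℕ.< d → sum (λ i → (w i * x i) * t i ^ j) ≈ 0#
    moment≈0 j j<d = begin-equality
      sum (λ i → (w i * x i) * t i ^ j)
        ≈⟨ sum-cong-≋ (λ i → *-assoc (w i) (x i) (t i ^ j)) ⟩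
      sum (λ i → w i * (x i * t i ^ j))
        ≡⟨ cong (λ j → sum (λ i → w i * (x i * t i ^ j))) (≡.sym (Fin.toℕ-fromℕ< j<d)) ⟩
      sum (λ i → w i * (x i * t i ^ toℕ (fromℕ< j<d)))
        ≈⟨ sum-cong-≋ (λ i → *-congˡ (sym (point≈ i (fromℕ< j<d)))) ⟩
      sum (λ i → w i * point S i (fromℕ< j<d))
        ≈⟨ combination≈0 (fromℕ< j<d) ⟩
      0# ∎
    g : Fin n → Carrier
    g i = x i * eval rs (t i)
    Σ≈0 : sum (λ i → w i * signed s (g i)) ≈ 0#
    Σ≈0 = begin-equality
      sum (λ i → w i * signed s (g i))
        ≈⟨ sum-cong-≋ (λ i → *-signed s (w i) (g i)) ⟩
      sum (λ i → signed s (w i * g i))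
        ≈⟨ signed-sum s (λ i → w i * g i) ⟩
      signed s (sum (λ i → w i * g i))
        ≈⟨ signed-cong s (sum-cong-≋ λ i →
             trans (sym (*-assoc (w i) (x i) _)) (*-congˡ (sym (*-identityʳ _)))) ⟩
      signed s (sum (λ i → (w i * x i) * (eval rs (t i) * t i ^ 0)))
        ≈⟨ signed-cong s (moment-eval d _ t moment≈0 rs 0
             (subst (ℕ._< d) (≡.sym (ℕ.+-identityʳ (length rs))) l<d)) ⟩
      signed s 0#
        ≈⟨ signed-0 s ⟩
      0# ∎
    0≤term : ∀ i → 0# ≤ w i * signed s (g i)
    0≤term i with i ∈? I
    ... | yes i∈I = *-nonNegative (0≤w i) (proj₁ (positive i i∈I))
    ... | no  i∉I = ≤-reflexive (sym (trans (*-congʳ (w∉≈0 i i∉I)) (zeroˡ _)))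
    w≈0 : ∀ i → w i ≈ 0#
    w≈0 i with i ∈? I
    ... | yes i∈I = ≉0-cancelˡ (proj₂ (positive i i∈I) ∘ sym)
                      (trans (*-comm _ (w i)) (nonNegative-sum≈0⇒≈0 _ 0≤term Σ≈0 i))
    ... | no  i∉I = w∉≈0 i i∉I

-- The point configuration, the depth of the origin, and the classification by sign changes.

module Configuration {c ℓ₁ ℓ₂} (ℝ : CompleteOrderedField c ℓ₁ ℓ₂) (m : ℕ) where

  open CompleteOrderedField ℝ hiding (zero)
  open Geometry ℝ
  open OrderedFieldProperties ℝ
  open RingProperties ring
  open SemiringSum semiring using (sum; sum-cong-≋; *-distribˡ-sum)
  open Separation ℝ

  -- The steps have length 2, so that `height k + 1#` lies strictly between the parameters used so
  -- far and the next one and can serve as a root.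
  height : ℕ → Carrier
  height zero    = 0#
  height (suc k) = (height k + 1#) + 1#

  param : ∀ k → Fin (size m k) → Carrier
  param zero    i             = 0#
  param (suc k) zero          = height (suc k)
  param (suc k) (suc zero)    = height (suc k)
  param (suc k) (suc (suc i)) = param k i

  -- The multiples are pairwise distinct: the first block uses 0, ..., m, with 0 giving the origin,
  -- and the multiples of each new pair exceed all earlier ones in absolute value.
  scale : ∀ k → Fin (size m k) → Carrier
  scale zero    i             = fromℕ (toℕ i)
  scale (suc k) zero          = fromℕ (size m k)
  scale (suc k) (suc zero)    = - fromℕ (size m k)
  scale (suc k) (suc (suc i)) = scale k i

  height<height-suc : ∀ k → height k < height (suc k)
  height<height-suc k = begin-strict
    height k      <⟨ x<x+1 (height k) ⟩
    height k + 1# <⟨ x<x+1 (height k + 1#) ⟩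
    height (suc k) ∎
    where open ≤-Reasoning

  param≤height : ∀ k i → param k i ≤ height k
  param≤height zero    i             = ≤-refl
  param≤height (suc k) zero          = ≤-refl
  param≤height (suc k) (suc zero)    = ≤-refl
  param≤height (suc k) (suc (suc i)) = ≤-trans (param≤height k i) (proj₁ (height<height-suc k))

  0<fromℕ-size : ∀ k → 0# < fromℕ (size m k)
  0<fromℕ-size zero    = fromℕ-mono-< {0} {suc m} (s≤s z≤n)
  0<fromℕ-size (suc k) = fromℕ-mono-< {0} {size m (suc k)} (s≤s z≤n)

  fromℕ-size<fromℕ-size-suc : ∀ k → fromℕ (size m k) < fromℕ (size m (suc k))
  fromℕ-size<fromℕ-size-suc k = fromℕ-mono-< {size m k} {size m (suc k)} (ℕ.m≤n⇒m≤1+n ℕ.≤-refl)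

  ∣scale∣<size : ∀ k i → scale k i < fromℕ (size m k) × - scale k i < fromℕ (size m k)
  ∣scale∣<size zero i = fromℕ-mono-< {toℕ i} {suc m} (Fin.toℕ<n i) , (begin-strict
    - fromℕ (toℕ i)  ≤⟨ 0≤x⇒-x≤0 (fromℕ-nonNegative (toℕ i)) ⟩
    0#               <⟨ 0<fromℕ-size zero ⟩
    fromℕ (suc m)    ∎)
    where open ≤-Reasoning
  ∣scale∣<size (suc k) zero = fromℕ-size<fromℕ-size-suc k , (begin-strict
    - fromℕ (size m k)     ≤⟨ 0≤x⇒-x≤0 (fromℕ-nonNegative (size m k)) ⟩
    0#                     <⟨ 0<fromℕ-size (suc k) ⟩
    fromℕ (size m (suc k)) ∎)
    where open ≤-Reasoning
  ∣scale∣<size (suc k) (suc zero) = proj₂ (∣scale∣<size (suc k) zero) , (begin-strict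
    - (- fromℕ (size m k)) ≈⟨ -‿involutive _ ⟩
    fromℕ (size m k)       <⟨ fromℕ-size<fromℕ-size-suc k ⟩
    fromℕ (size m (suc k)) ∎)
    where open ≤-Reasoning
  ∣scale∣<size (suc k) (suc (suc i)) =
    <-trans (proj₁ (∣scale∣<size k i)) (fromℕ-size<fromℕ-size-suc k) ,
    <-trans (proj₂ (∣scale∣<size k i)) (fromℕ-size<fromℕ-size-suc k)

  size≉-size : ∀ k → fromℕ (size m k) ≉ - fromℕ (size m k)
  size≉-size k eq = <⇒≱ (0<fromℕ-size k) (≤-respˡ-≈ (sym eq) (0≤x⇒-x≤0 (fromℕ-nonNegative (size m k))))

  scale≉size : ∀ k i → scale k i ≉ fromℕ (size m k)
  scale≉size k i = proj₂ (proj₁ (∣scale∣<size k i))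

  scale≉-size : ∀ k i → scale k i ≉ - fromℕ (size m k)
  scale≉-size k i eq = proj₂ (proj₂ (∣scale∣<size k i)) (trans (-‿cong eq) (-‿involutive _))

  scale-injective : ∀ k {i j} → scale k i ≈ scale k j → i ≡ j
  scale-injective zero    {i} {j} eq = Fin.toℕ-injective (fromℕ-injective {toℕ i} {toℕ j} eq)
  scale-injective (suc k) {zero}        {zero}        eq = ≡.refl
  scale-injective (suc k) {zero}        {suc zero}    eq = contradiction eq (size≉-size k)
  scale-injective (suc k) {zero}        {suc (suc j)} eq = contradiction (sym eq) (scale≉size k j)
  scale-injective (suc k) {suc zero}    {zero}        eq = contradiction (sym eq) (size≉-size k)
  scale-injective (suc k) {suc zero}    {suc zero}    eq = ≡.refl
  scale-injective (suc k) {suc zero}    {suc (suc j)} eq = contradiction (sym eq) (scale≉-size k j)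
  scale-injective (suc k) {suc (suc i)} {zero}        eq = contradiction eq (scale≉size k i)
  scale-injective (suc k) {suc (suc i)} {suc zero}    eq = contradiction eq (scale≉-size k i)
  scale-injective (suc k) {suc (suc i)} {suc (suc j)} eq = cong skip (scale-injective k eq)

  configuration : ∀ d k → PointSet (suc d) (size m k)
  configuration d k = record
    { point    = λ i j → scale k i * param k i ^ toℕ j
    -- Coordinate zero has exponent 0, so it is the scale itself and already tells the points apart.
    ; distinct = λ p≋q → scale-injective k
        (trans (sym (*-identityʳ _)) (trans (p≋q zero) (*-identityʳ _)))
    }

  module _ {d : ℕ} (a : Point d) where

    value : ∀ k → Fin (size m k) → Carrier
    value k i = a ∙ λ j → scale k i * param k i ^ toℕ j

    value≈ : ∀ k i → value k i ≈ scale k i * sum (λ j → a j * param k i ^ toℕ j)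
    value≈ k i = trans
      (sum-cong-≋ λ j → solve 3 (λ a x t → a :* (x :* t) := x :* (a :* t)) refl
                          (a j) (scale k i) (param k i ^ toℕ j))
      (sym (*-distribˡ-sum (scale k i) λ j → a j * param k i ^ toℕ j))
      where open NaturalCoefficients commutativeSemiring

    NonNegativeValues : ∀ k → List (Fin (size m k)) → Set _
    NonNegativeValues k xs = Unique xs × All (λ i → 0# ≤ value k i) xs × length xs ≡ suc k

    -- By `value≈` the two points of a pair have opposite values, namely plus and minus the same
    -- multiple of one polynomial value, so one of them is nonnegative. Together with the origin
    -- this yields one index for each pair and one more.
    nonNegativeValues : ∀ k → ∃ (NonNegativeValues k)
    nonNegativeValues zero =
      zero ∷ [] , ([] ∷ []) , (≤-reflexive (sym (trans (value≈ zero zero) (zeroˡ _))) ∷ []) , ≡.refl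
    nonNegativeValues (suc k) with nonNegativeValues k | total 0# (sum λ j → a j * height (suc k) ^ toℕ j)
    ... | xs , u , 0≤v , l | inj₁ 0≤q =
      zero ∷ map (skip) xs ,
      All.map⁺ (All.universal (λ _ ()) xs) ∷ Unique.map⁺ (λ { ≡.refl → ≡.refl }) u ,
      ≤-respʳ-≈ (sym (value≈ (suc k) zero)) (*-nonNegative (fromℕ-nonNegative (size m k)) 0≤q) ∷ All.map⁺ 0≤v ,
      cong suc (≡.trans (length-map (skip) xs) l)
    ... | xs , u , 0≤v , l | inj₂ q≤0 =
      suc zero ∷ map (skip) xs ,
      All.map⁺ (All.universal (λ _ ()) xs) ∷ Unique.map⁺ (λ { ≡.refl → ≡.refl }) u ,
      ≤-respʳ-≈ (trans (trans (sym (-‿distribʳ-* _ _)) (-‿distribˡ-* _ _)) (sym (value≈ (suc k) (suc zero))))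
        (*-nonNegative (fromℕ-nonNegative (size m k)) (x≤0⇒0≤-x q≤0)) ∷ All.map⁺ 0≤v ,
      cong suc (≡.trans (length-map (skip) xs) l)

  -- A halfspace containing the origin has offset at most 0, so it contains every point on which its
  -- normal is nonnegative.
  configuration-depth : ∀ d k {β} → β ≤ fromℕ (suc k) → AtDepth origin β (configuration d k)
  configuration-depth d k β≤1+k H 0∈H with nonNegativeValues (ClosedHalfspace.normal H) k
  ... | xs , u , 0≤v , l =
    xs , u , All.map (≤-trans offset≤0) 0≤v , ≤-trans β≤1+k (≤-reflexive (reflexive (cong fromℕ (≡.sym l))))
    where
    open ClosedHalfspace H
    offset≤0 : offset ≤ 0#
    offset≤0 = ≤-trans 0∈H (≤-reflexive
      (trans (sum-cong-≋ λ j → *-comm (normal j) 0#)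
        (trans (sym (*-distribˡ-sum 0# normal)) (zeroˡ _))))

  -- A certificate of separation by a polynomial of degree `r`. In the classification `r` is the
  -- number of sign changes of `I` and `s` the sign of its element with the greatest parameter.
  -- Keeping the roots below `height k` makes the polynomial positive at all later parameters.
  record Separated (k : ℕ) (I : Subset (size m k)) (s : Bool) (r : ℕ) : Set (c ⊔ ℓ₁ ⊔ ℓ₂) where
    field
      roots        : List Carrier
      length-roots : length roots ≡ r
      roots<height : All (_< height k) roots
      positive     : ∀ i → i ∈ I → 0# < signed s (scale k i * eval roots (param k i))

  open Separated

  -- At the new top parameter the polynomial is positive, since all roots lie below it, and the sign
  -- of the new point cancels against `s`. Only the lower points need a separate argument.
  single-positive : ∀ k (I : Subset (size m k)) s rs → All (_< height (suc k)) rs →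
    (∀ i → i ∈ I → 0# < signed s (scale k i * eval rs (param k i))) →
    ∀ i → i ∈ single s I → 0# < signed s (scale (suc k) i * eval rs (param (suc k) i))
  single-positive k I true  rs rs<h pos zero          i∈ = *-positive (0<fromℕ-size k) (eval-positive rs<h)
  single-positive k I false rs rs<h pos (suc zero)    i∈ =
    <-respʳ-≈ (trans (sym (signed-involutive false _)) (signed-cong false (sym (signed-* false _ _))))
      (*-positive (0<fromℕ-size k) (eval-positive rs<h))
  single-positive k I s     rs rs<h pos (suc (suc i)) (there (there i∈I)) = pos i i∈I

  ∣I∣≡0⇒separated : ∀ k (I : Subset (size m k)) s → ∣ I ∣ ≡ 0 → Separated (suc k) (single s I) s 0
  ∣I∣≡0⇒separated k I s ∣I∣≡0 = record
    { roots        = []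
    ; length-roots = ≡.refl
    ; roots<height = []
    ; positive     = single-positive k I s [] [] λ i i∈I → contradiction i∈I (∣I∣≡0⇒∉ I ∣I∣≡0 i)
    }

  separated-none : ∀ k {I s r} → Separated k I s r → Separated (suc k) (none I) s r
  separated-none k sep = record
    { roots        = roots sep
    ; length-roots = length-roots sep
    ; roots<height = All.map (λ r<h → <-trans r<h (height<height-suc k)) (roots<height sep)
    ; positive     = λ { (suc (suc i)) (there (there i∈I)) → positive sep i i∈I }
    }

  separated-same : ∀ k {I s r} → Separated k I s r → Separated (suc k) (single s I) s r
  separated-same k {I} {s} sep = record
    { roots        = roots sep
    ; length-roots = length-roots sep
    ; roots<height = rs<h
    ; positive     = single-positive k I s (roots sep) rs<h (positive sep)
    }
    where
    rs<h = All.map (λ r<h → <-trans r<h (height<height-suc k)) (roots<height sep)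

  -- The new root `ρ` lies above all old parameters and below the new one. The factor `t - ρ` is
  -- therefore negative at every old point, which turns `not s` into `s`, and positive at the new
  -- point.
  separated-flip : ∀ k {I s r} → Separated k I (not s) r → Separated (suc k) (single s I) s (suc r)
  separated-flip k {I} {s} sep = record
    { roots        = ρ ∷ roots sep
    ; length-roots = cong suc (length-roots sep)
    ; roots<height = rs<h
    ; positive     = single-positive k I s (ρ ∷ roots sep) rs<h λ i i∈I →
        <-respʳ-≈ (identity (scale k i) (param k i) (eval (roots sep) (param k i)))
          (*-positive (x<y⇒0<y-x (≤-<-trans (param≤height k i) (x<x+1 (height k)))) (positive sep i i∈I))
    }
    where
    open NaturalCoefficients commutativeSemiring
    open ≤-Reasoning
    ρ = height k + 1#
    rs<h = x<x+1 ρ ∷ All.map (λ r<h → <-trans r<h (height<height-suc k)) (roots<height sep)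
    identity : ∀ x t e → (ρ - t) * signed (not s) (x * e) ≈ signed s (x * ((t - ρ) * e))
    identity x t e = begin-equality
      (ρ - t) * signed (not s) (x * e)
        ≈⟨ *-signed (not s) _ _ ⟩
      signed (not s) ((ρ - t) * (x * e))
        ≈⟨ signed-cong (not s) (*-congʳ (sym (⁻¹-anti-homo‿- t ρ))) ⟩
      signed (not s) (- (t - ρ) * (x * e))
        ≈⟨ signed-cong (not s) (sym (-‿distribˡ-* _ _)) ⟩
      signed (not s) (- ((t - ρ) * (x * e)))
        ≈⟨ signed-not-neg s _ ⟩
      signed s ((t - ρ) * (x * e))
        ≈⟨ signed-cong s (solve 3 (λ y x e → y :* (x :* e) := x :* (y :* e)) refl (t - ρ) x e) ⟩
      signed s (x * ((t - ρ) * e)) ∎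

  -- The cases compare the size of `I` with its number `r` of sign changes: size `suc r` means that
  -- the signs alternate, a greater size that some sign repeats. The empty set has no first sign and
  -- so is listed under both. Alternating sets carry a certificate as well, since a further point of
  -- equal sign makes them separated.
  data Classification (k : ℕ) (I : Subset (size m k)) : Set (c ⊔ ℓ₁ ⊔ ℓ₂) where
    isDegenerate  : I List.∈ degenerate m k ∣ I ∣ → Classification k I
    isEmpty       : ∣ I ∣ ≡ 0 → (∀ s → I List.∈ alternating m k s 0) → Classification k I
    isAlternating : ∀ s r → Separated k I s r → ∣ I ∣ ≡ suc r → I List.∈ alternating m k s (suc r) →
                    Classification k I
    isSeparated   : ∀ s r → Separated k I s r → suc r ℕ.< ∣ I ∣ → Classification k I

  cluster-separated : ∀ (I : Subset m) → Separated zero (false ∷ I) true 0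
  cluster-separated I = record
    { roots        = []
    ; length-roots = ≡.refl
    ; roots<height = []
    ; positive     = λ { (suc i) _ → *-positive (fromℕ-mono-< {0} {suc (toℕ i)} (s≤s z≤n)) 0<1 }
    }

  -- The `m` lowest points are all positive multiples, so the constant polynomial 1 separates them.
  -- One of them alone is alternating with sign `true`; two or more repeat a sign.
  classify-cluster : ∀ (I : Subset m) n → ∣ I ∣ ≡ n → I List.∈ subsets m n → Classification zero (false ∷ I)
  classify-cluster I zero          ∣I∣≡n I∈ = isEmpty ∣I∣≡n λ s → ∈-map⁺ (false ∷_) I∈
  classify-cluster I (suc zero)    ∣I∣≡n I∈ =
    isAlternating true 0 (cluster-separated I) ∣I∣≡n (∈-map⁺ (false ∷_) I∈)
  classify-cluster I (suc (suc n)) ∣I∣≡n I∈ =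
    isSeparated true 0 (cluster-separated I) (subst (1 ℕ.<_) (≡.sym ∣I∣≡n) (s≤s (s≤s z≤n)))

  -- A new top point raises the size by one. It raises `r` only if its sign differs from the first
  -- sign of `I`, so an alternating set stays alternating exactly in that case, and a repeated sign
  -- persists.
  classify-single : ∀ k (I : Subset (size m k)) s → Classification k I → Classification (suc k) (single s I)
  classify-single k I s (isDegenerate I∈) =
    isDegenerate (subst (λ e → single s I List.∈ degenerate m (suc k) e) (≡.sym (∣single∣ s I))
      (degenerate-single k s I∈))
  -- The recursion of `alternating` asks for the remainder with sign `not s`; the empty set is
  -- available under either sign.
  classify-single k I s (isEmpty ∣I∣≡0 I∈) =
    isAlternating s 0 (∣I∣≡0⇒separated k I s ∣I∣≡0) (≡.trans (∣single∣ s I) (cong suc ∣I∣≡0))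
      (alternating-single k s 0 (I∈ (not s)))
  classify-single k I s (isAlternating s′ r sep ∣I∣≡ I∈) with s Bool.≟ s′
  ... | yes ≡.refl = isSeparated s r (separated-same k sep)
    (ℕ.≤-reflexive (≡.sym (≡.trans (∣single∣ s I) (cong suc ∣I∣≡))))
  ... | no  s≢s′ with ≡.refl ← Bool.¬-not (s≢s′ ∘ ≡.sym) =
    isAlternating s (suc r) (separated-flip k sep) (≡.trans (∣single∣ s I) (cong suc ∣I∣≡))
      (alternating-single k s (suc r) I∈)
  classify-single k I s (isSeparated s′ r sep r<) with s Bool.≟ s′
  ... | yes ≡.refl = isSeparated s r (separated-same k sep)
    (subst (suc r ℕ.<_) (≡.sym (∣single∣ s I)) (ℕ.m≤n⇒m≤1+n r<))
  ... | no  s≢s′ with ≡.refl ← Bool.¬-not (s≢s′ ∘ ≡.sym) =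
    isSeparated s (suc r) (separated-flip k sep)
      (subst (suc (suc r) ℕ.<_) (≡.sym (∣single∣ s I)) (s≤s r<))

  classify : ∀ k (I : Subset (size m k)) → Classification k I
  classify zero (true  ∷ I) = isDegenerate (∈-map⁺ (true ∷_) (∈-subsets I))
  classify zero (false ∷ I) = classify-cluster I ∣ I ∣ ≡.refl (∈-subsets I)
  classify (suc k) (true  ∷ true  ∷ I) = isDegenerate (degenerate-both k I)
  classify (suc k) (true  ∷ false ∷ I) = classify-single k I true (classify k I)
  classify (suc k) (false ∷ true  ∷ I) = classify-single k I false (classify k I)
  classify (suc k) (false ∷ false ∷ I) with classify k I
  ... | isDegenerate I∈                  = isDegenerate (degenerate-none k I∈)
  ... | isEmpty ∣I∣≡0 I∈                 = isEmpty ∣I∣≡0 λ s → alternating-none k s 0 (I∈ s)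
  ... | isAlternating s r sep ∣I∣≡1+r I∈ =
    isAlternating s r (separated-none k sep) ∣I∣≡1+r (alternating-none k s (suc r) I∈)
  ... | isSeparated s r sep r<           = isSeparated s r (separated-none k sep) r<

-- The simplices around the origin and the numerical bound.

module SimplexCount {c ℓ₁ ℓ₂} (ℝ : CompleteOrderedField c ℓ₁ ℓ₂) where

  open CompleteOrderedField ℝ hiding (zero)
  open Geometry ℝ
  open OrderedFieldProperties ℝ
  open Separation ℝ
  open Configuration ℝ
  open RingProperties ring
  open Exp semiring using (^-congˡ)
  open CommutativeExp commutativeSemiring using (^-distrib-*)
  open NaturalCoefficients commutativeSemiring using (solve; _:+_; _:*_; _:=_)
  open ≤-Reasoning

  -- The dimension is `suc d`, so simplices have `suc (suc d)` vertices. A separated set of this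
  -- size has `r` below `suc d`, a degree small enough for `separated⇒∉hull`.
  simplex⇒candidate : ∀ m d k {I} → SimplexContaining origin (configuration m d k) I →
                      I List.∈ candidates m k (suc (suc d))
  simplex⇒candidate m d k {I} (∣I∣≡2+d , hull) with classify m k I
  ... | isDegenerate I∈ = ∈-++⁺ˡ (subst (λ e → I List.∈ degenerate m k e) ∣I∣≡2+d I∈)
  ... | isEmpty ∣I∣≡0 _ = contradiction (≡.trans (≡.sym ∣I∣≡2+d) ∣I∣≡0) λ ()
  ... | isAlternating true r sep ∣I∣≡1+r I∈ = ∈-++⁺ʳ (degenerate m k _)
    (∈-++⁺ˡ (subst (λ e → I List.∈ alternating m k true e) (≡.trans (≡.sym ∣I∣≡1+r) ∣I∣≡2+d) I∈))
  ... | isAlternating false r sep ∣I∣≡1+r I∈ = ∈-++⁺ʳ (degenerate m k _)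
    (∈-++⁺ʳ (alternating m k true _)
      (subst (λ e → I List.∈ alternating m k false e) (≡.trans (≡.sym ∣I∣≡1+r) ∣I∣≡2+d) I∈))
  ... | isSeparated s r sep 1+r<∣I∣ = contradiction hull
    (separated⇒∉hull (configuration m d k) I (scale m k) (param m k) (λ i j → refl) s roots
      (subst (ℕ._< suc d) (≡.sym length-roots) (ℕ.≤-pred (subst (suc r ℕ.<_) ∣I∣≡2+d 1+r<∣I∣))) positive)
    where open Separated m sep

  0<2 : 0# < fromℕ 2
  0<2 = fromℕ-mono-< {0} {2} (s≤s z≤n)

  2*α≤1 : ∀ {α} → α ≤ 1# / fromℕ 2 → fromℕ 2 * α ≤ 1#
  2*α≤1 {α} α≤½ = begin
    fromℕ 2 * α               ≤⟨ *-monoʳ-≤ (proj₁ 0<2) α≤½ ⟩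
    fromℕ 2 * (1# / fromℕ 2)  ≈⟨ *-congˡ (*-identityˡ _) ⟩
    fromℕ 2 * fromℕ 2 ⁻¹      ≈⟨ ⁻¹-inverseʳ (fromℕ 2) (proj₂ 0<2 ∘ sym) ⟩
    1#                        ∎

  module _ (d : ℕ) (α : Carrier) where

    leading : Carrier
    leading = fromℕ (suc d) * α ^ d - fromℕ (2 ℕ.* d) * α ^ suc d

    -- The first summand accounts for the degenerate sets, the second for rounding `α * N` to an
    -- integer.
    errorConstant : Carrier
    errorConstant = fromℕ 2 ^ d + fromℕ (suc d) * α ^ d / fromℕ (suc d !)

    -- With `β = α * N`, raising `k` to `β` and adding `2 * d * β ^ (d + 1)` gives a sum that
    -- factors as `(d + 1) * β ^ d * (m + 2 * β)`. The last factor is at most `N + 1`; its part `N`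
    -- gives the main term and its part 1 the error.
    alternating-bound : ∀ m k → 0# ≤ α → let N = fromℕ (size m k) in
      fromℕ k ≤ α * N → α * N ≤ fromℕ (suc k) →
      fromℕ (2 ℕ.* k ℕ.^ suc d ℕ.+ suc d ℕ.* (k ℕ.^ d ℕ.* m)) ≤
      leading * N ^ suc d + fromℕ (suc d) * α ^ d * N ^ d
    -- The subtracted part of `leading` is moved to the other side, which keeps the rearrangements
    -- within a semiring.
    alternating-bound m k 0≤α k≤β β≤1+k = +-cancelʳ-≤ (q * N ^ suc d) (begin
      fromℕ (2 ℕ.* k ℕ.^ suc d ℕ.+ suc d ℕ.* (k ℕ.^ d ℕ.* m)) + q * N ^ suc d
        ≈⟨ +-congʳ fromℕ-bound ⟩
      two * fromℕ k ^ suc d + E * (fromℕ k ^ d * M) + q * N ^ suc d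
        ≤⟨ +-monoˡ-≤ (q * N ^ suc d) (+-mono-≤
             (*-monoʳ-≤ (fromℕ-nonNegative 2) (^-monoˡ-≤ (fromℕ-nonNegative k) k≤β (suc d)))
             (*-monoʳ-≤ (fromℕ-nonNegative (suc d)) (*-monoˡ-≤ (fromℕ-nonNegative m)
               (^-monoˡ-≤ (fromℕ-nonNegative k) k≤β d)))) ⟩
      two * β ^ suc d + E * (β ^ d * M) + q * N ^ suc d
        ≈⟨ +-congˡ (trans (*-congʳ (*-congʳ (fromℕ-* 2 d)))
             (solve 6 (λ t f a p n q → t :* f :* (a :* p) :* (n :* q)
                                       := t :* f :* (a :* n :* (p :* q))) refl two (fromℕ d) α (α ^ d) N (N ^ d))) ⟩
      two * β ^ suc d + E * (β ^ d * M) + two * fromℕ d * (β * (α ^ d * N ^ d))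
        ≈⟨ +-cong (+-congʳ (*-congʳ (sym (*-identityˡ two)))) (*-congˡ (*-congˡ (sym (^-distrib-* α N d)))) ⟩
      1# * two * (β * β ^ d) + E * (β ^ d * M) + two * fromℕ d * (β * β ^ d)
        -- `1#` enters as the variable `o`, so that `E`, which unfolds to `1# + fromℕ d`, matches
        -- `o :+ f`.
        ≈⟨ solve 6 (λ o t f b u m → o :* t :* (b :* u) :+ (o :+ f) :* (u :* m) :+ t :* f :* (b :* u)
                                 := (o :+ f) :* u :* (m :+ t :* b)) refl 1# two (fromℕ d) β (β ^ d) M ⟩
      E * β ^ d * (M + two * β)
        ≤⟨ *-monoʳ-≤ (*-nonNegative (fromℕ-nonNegative (suc d)) (^-nonNegative 0≤β d)) M+2β≤N+1 ⟩
      E * β ^ d * (N + 1#)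
        ≈⟨ *-congʳ (*-congˡ (^-distrib-* α N d)) ⟩
      E * (α ^ d * N ^ d) * (N + 1#)
        ≈⟨ solve 5 (λ e a q n o → e :* (a :* q) :* (n :+ o) := e :* a :* (n :* q) :+ o :* (e :* a :* q))
             refl E (α ^ d) (N ^ d) N 1# ⟩
      p * N ^ suc d + 1# * (p * N ^ d)
        ≈⟨ +-cong (*-congʳ (sym ([y-x]+x≈y q p))) (*-identityˡ _) ⟩
      (p - q + q) * N ^ suc d + p * N ^ d
        ≈⟨ solve 4 (λ l q y r → (l :+ q) :* y :+ r := (l :* y :+ r) :+ q :* y)
             refl (p - q) q (N ^ suc d) (p * N ^ d) ⟩
      leading * N ^ suc d + p * N ^ d + q * N ^ suc d ∎)
      where
      N = fromℕ (size m k)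
      M = fromℕ m
      E = fromℕ (suc d)
      two = fromℕ 2
      β = α * N
      0≤β = *-nonNegative 0≤α (fromℕ-nonNegative (size m k))
      p = E * α ^ d
      q = fromℕ (2 ℕ.* d) * α ^ suc d
      fromℕ-bound : fromℕ (2 ℕ.* k ℕ.^ suc d ℕ.+ suc d ℕ.* (k ℕ.^ d ℕ.* m)) ≈
                    two * fromℕ k ^ suc d + E * (fromℕ k ^ d * M)
      fromℕ-bound = trans (fromℕ-+ (2 ℕ.* k ℕ.^ suc d) _) (+-cong
        (trans (fromℕ-* 2 (k ℕ.^ suc d)) (*-congˡ (fromℕ-^ k (suc d))))
        (trans (fromℕ-* (suc d) (k ℕ.^ d ℕ.* m))
          (*-congˡ (trans (fromℕ-* (k ℕ.^ d) m) (*-congʳ (fromℕ-^ k d))))))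
      -- Since `N` is `2k + 1 + m`, replacing `β` by `k + 1` overshoots `N` by exactly 1.
      M+2β≤N+1 : M + two * β ≤ N + 1#
      M+2β≤N+1 = begin
        M + two * β                ≤⟨ +-monoʳ-≤ M (*-monoʳ-≤ (fromℕ-nonNegative 2) β≤1+k) ⟩
        M + two * fromℕ (suc k)    ≈⟨ +-congˡ (fromℕ-* 2 (suc k)) ⟨
        M + fromℕ (2 ℕ.* suc k)    ≈⟨ fromℕ-+ m (2 ℕ.* suc k) ⟨
        fromℕ (m ℕ.+ 2 ℕ.* suc k)  ≡⟨ cong fromℕ (≡.trans (m+2*1+k≡ m k) (cong (ℕ._+ 1) (≡.sym (size≡ m k)))) ⟩
        fromℕ (size m k ℕ.+ 1)     ≈⟨ fromℕ-+ (size m k) 1 ⟩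
        N + (1# + 0#)              ≈⟨ +-congˡ (+-identityʳ 1#) ⟩
        N + 1#                     ∎
        where
        m+2*1+k≡ : ∀ m k → m ℕ.+ 2 ℕ.* suc k ≡ suc (2 ℕ.* k) ℕ.+ m ℕ.+ 1
        m+2*1+k≡ = S.solve 2 (λ m k → m S.:+ S.con 2 S.:* (S.con 1 S.:+ k)
                                      S.:= S.con 1 S.:+ S.con 2 S.:* k S.:+ m S.:+ S.con 1) ≡.refl
          where module S = +-*-Solver

    candidates-bound : ∀ m k → 0# ≤ α → let N = fromℕ (size m k) in
      fromℕ k ≤ α * N → α * N ≤ fromℕ (suc k) →
      fromℕ (length (candidates m k (suc d))) ≤
      leading * (N ^ suc d / fromℕ (suc d !)) + errorConstant * N ^ d
    candidates-bound m k 0≤α k≤β β≤1+k with length-candidates m k d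
    ... | l , length≤ , [1+d]!*l≤ = begin
      fromℕ (length (candidates m k (suc d)))
        ≤⟨ fromℕ-mono-≤ length≤ ⟩
      fromℕ ((2 ℕ.* size m k) ℕ.^ d ℕ.+ l)
        ≈⟨ fromℕ-+ ((2 ℕ.* size m k) ℕ.^ d) l ⟩
      fromℕ ((2 ℕ.* size m k) ℕ.^ d) + fromℕ l
        ≈⟨ +-congʳ (trans (fromℕ-^ (2 ℕ.* size m k) d)
           (trans (^-congˡ d (fromℕ-* 2 (size m k))) (^-distrib-* (fromℕ 2) N d))) ⟩
      fromℕ 2 ^ d * N ^ d + fromℕ l
        ≤⟨ +-monoʳ-≤ _ (y*x≤z⇒x≤z/y 0<D (begin
             D * fromℕ l                                                ≈⟨ fromℕ-* (suc d !) l ⟨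
             fromℕ (suc d ! ℕ.* l)                                      ≤⟨ fromℕ-mono-≤ [1+d]!*l≤ ⟩
             fromℕ (2 ℕ.* k ℕ.^ suc d ℕ.+ suc d ℕ.* (k ℕ.^ d ℕ.* m))    ≤⟨ alternating-bound m k 0≤α k≤β β≤1+k ⟩
             leading * N ^ suc d + fromℕ (suc d) * α ^ d * N ^ d        ∎)) ⟩
      fromℕ 2 ^ d * N ^ d + (leading * N ^ suc d + fromℕ (suc d) * α ^ d * N ^ d) / D
        ≈⟨ solve 6 (λ t n l y p i → t :* n :+ (l :* y :+ p :* n) :* i := l :* (y :* i) :+ (t :+ p :* i) :* n)
             refl (fromℕ 2 ^ d) (N ^ d) leading (N ^ suc d) (fromℕ (suc d) * α ^ d) (D ⁻¹) ⟩
      leading * (N ^ suc d / D) + errorConstant * N ^ d ∎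
      where
      N = fromℕ (size m k)
      D = fromℕ (suc d !)
      0<D : 0# < D
      0<D = fromℕ-mono-< {0} {suc d !} (ℕ.>-nonZero⁻¹ _ {{ℕ._!≢0 (suc d)}})

  -- Take `k` to be the greatest integer strictly below `α * n`. As `α` is at most 1/2, this forces
  -- `2k < n`, so the origin and `k` pairs fit, and `m` is the number of points left over, with no
  -- truncation in the subtraction.
  decompose : ∀ {α} n → 1 ℕ.≤ n → 0# < α → α ≤ 1# / fromℕ 2 →
    ∃ λ m → ∃ λ k → n ≡ size m k × fromℕ k ≤ α * fromℕ n × α * fromℕ n ≤ fromℕ (suc k)
  decompose {α} n 1≤n 0<α α≤½ =
    n ℕ.∸ suc (2 ℕ.* k) , k ,
    ≡.sym (≡.trans (size≡ _ k) (ℕ.m+[n∸m]≡n 2k<n)) ,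
    proj₁ k<β , β≤1+k
    where
    β = α * fromℕ n
    0<β : 0# < β
    0<β = *-positive 0<α (fromℕ-mono-< {0} {n} 1≤n)
    2β≤n : fromℕ 2 * β ≤ fromℕ n
    2β≤n = begin
      fromℕ 2 * β            ≈⟨ *-assoc (fromℕ 2) α (fromℕ n) ⟨
      fromℕ 2 * α * fromℕ n  ≤⟨ *-monoˡ-≤ (fromℕ-nonNegative n) (2*α≤1 α≤½) ⟩
      1# * fromℕ n           ≈⟨ *-identityˡ _ ⟩
      fromℕ n                ∎
    β≤n : β ≤ fromℕ n
    β≤n = begin
      β           ≈⟨ *-identityˡ β ⟨
      1# * β      ≈⟨ *-congʳ (+-identityʳ 1#) ⟨
      fromℕ 1 * β ≤⟨ *-monoˡ-≤ (proj₁ 0<β) (fromℕ-mono-≤ {1} {2} (s≤s z≤n)) ⟩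
      fromℕ 2 * β ≤⟨ 2β≤n ⟩
      fromℕ n     ∎
    ceiling = ⌈ n ⌉-1 0<β β≤n
    k     = proj₁ ceiling
    k<β   = proj₁ (proj₂ ceiling)
    β≤1+k = proj₂ (proj₂ ceiling)
    2k<n : 2 ℕ.* k ℕ.< n
    2k<n = fromℕ-cancel-< (2 ℕ.* k) n (begin-strict
      fromℕ (2 ℕ.* k)   ≈⟨ fromℕ-* 2 k ⟩
      fromℕ 2 * fromℕ k <⟨ *-monoʳ-< 0<2 k<β ⟩
      fromℕ 2 * β       ≤⟨ 2β≤n ⟩
      fromℕ n           ∎)

theorem5 : ∀ {c ℓ₁ ℓ₂} (ℝ : CompleteOrderedField c ℓ₁ ℓ₂) →
    let open CompleteOrderedField ℝ
        open Geometry ℝ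
    in
    (d : ℕ) → 1 ℕ.≤ d →
    (α : Carrier) → 0# < α → α ≤ 1# / fromℕ 2 →
    ∃ λ (C : Carrier) →
      (n : ℕ) → 1 ℕ.≤ n →
      ∃ λ (S : PointSet d n) →
        AtDepth origin (α * fromℕ n) S ×
        AtMost
          ((fromℕ (suc d) * α ^ d - fromℕ (2 ℕ.* d) * α ^ suc d)
             * (fromℕ n ^ suc d / fromℕ (suc d !))
           + C * fromℕ n ^ d)
          (SimplexContaining origin S)
-- The constant is fixed before `n` is given, and depends on the dimension and `α` alone.
theorem5 ℝ (suc d) _ α 0<α α≤½ = errorConstant (suc d) α , λ n 1≤n → construct (decompose n 1≤n 0<α α≤½)
  where
  open CompleteOrderedField ℝ
  open Geometry ℝ
  open OrderedFieldProperties ℝ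
  open Configuration ℝ
  open SimplexCount ℝ
  construct : ∀ {n} →
    (∃ λ m → ∃ λ k → n ≡ size m k × fromℕ k ≤ α * fromℕ n × α * fromℕ n ≤ fromℕ (suc k)) →
    ∃ λ (S : PointSet (suc d) n) →
      AtDepth origin (α * fromℕ n) S ×
      AtMost (leading (suc d) α * (fromℕ n ^ suc (suc d) / fromℕ (suc (suc d) !))
              + errorConstant (suc d) α * fromℕ n ^ suc d)
        (SimplexContaining origin S)
  construct (m , k , ≡.refl , k≤β , β≤1+k) =
    -- A list of distinct simplices around the origin is contained in `candidates`, hence is no
    -- longer than that list.
    configuration m d k , configuration-depth m d k β≤1+k , λ xs unique simplices →
      ≤-trans (fromℕ-mono-≤ (unique-⊆⇒length≤ unique λ I∈xs →
          simplex⇒candidate m d k (All.lookup simplices I∈xs)))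
        (candidates-bound (suc d) α m k (proj₁ 0<α) k≤β β≤1+k)
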